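{- Let $\mathrm{H}$ be a finite group and $\sigma\in\mathrm{Aut}(\mathrm{H})$ with $\sigma^2=\mathrm{Id}$. Then there exists a Sylow $2$-subgroup $P_2\le\mathrm{H}$ with $\sigma(P_2)=P_2$ such that $\mathcal{G}_{\mathrm{TF}}(\mathrm{H},\sigma)\le\mathcal{G}_{\mathrm{TF}}(P_2,\sigma|_{P_2})$.
   Context: For a finite group $K$ and $\tau\in\mathrm{Aut}(K)$ with $\tau^2=\mathrm{Id}$: $\mathbb{Z}_2=\{e,x\}$, $K\rtimes_\theta\mathbb{Z}_2$ is the semidirect product with $\theta(x)=\tau$ (so $xkx=\tau(k)$), $K$ is identified with $K\times\{e\}$, $S(K,\tau)$ is the set of $g\in K\rtimes_\theta\mathbb{Z}_2$ with $g\notin K$ and $g^2=e$, and $\mathcal{G}_{\mathrm{TF}}(K,\tau)$ is the number of conjugacy classes of $K\rtimes_\theta\mathbb{Z}_2$ contained in $S(K,\tau)$. -}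

module Defs where

open import Data.Nat using (ℕ; _≤ᵇ_; _*_; _^_)
open import Data.Nat.Divisibility using (_∣_)
open import Data.Fin using (Fin; toℕ)
open import Data.Fin.Properties using (_≟_)
open import Data.Bool using (Bool; true; false; _∧_; _xor_; not; if_then_else_)
open import Data.List using (List; filter; length)
open import Data.Bool.ListAction using (all)
open import Data.List using () renaming (allFin to allFinL)
open import Data.Product using (_×_; _,_; proj₁; proj₂; Σ; ∃)
open import Relation.Nullary.Decidable using (⌊_⌋)
open import Relation.Binary.PropositionalEquality using (_≡_)
open import Relation.Unary using (Pred)
open import Relation.Nullary using (¬_)

record FinGroup : Set where
  field
    order : ℕ
    _·_   : Fin order → Fin order → Fin order
    e     : Fin order
    inv   : Fin order → Fin order
    assoc     : ∀ x y z → (x · y) · z ≡ x · (y · z)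
    identityˡ : ∀ x → e · x ≡ x
    identityʳ : ∀ x → x · e ≡ x
    inverseˡ  : ∀ x → inv x · x ≡ e
    inverseʳ  : ∀ x → x · inv x ≡ e

module _ (H : FinGroup) where
  open FinGroup H

  El : Set
  El = Fin order

  -- σ is an automorphism of H with σ² = Id (an endomorphism with σ∘σ = id is bijective)
  record InvolutiveAut (σ : El → El) : Set where
    field
      hom : ∀ x y → σ (x · y) ≡ σ x · σ y
      inv : ∀ x → σ (σ x) ≡ x

  Subset : Set
  Subset = El → Bool

  _∈_ : El → Subset → Set
  x ∈ P = P x ≡ true

  card : Subset → ℕ
  card P = length (filter (λ x → P x Data.Bool.≟ true) (allFinL order))

  record IsSubgroup (P : Subset) : Set where
    field
      e∈   : e ∈ P
      ·∈   : ∀ x y → x ∈ P → y ∈ P → (x · y) ∈ P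
      inv∈ : ∀ x → x ∈ P → inv x ∈ P

  record IsSylow2 (P : Subset) : Set where
    field
      subgroup : IsSubgroup P
      a        : ℕ
      m        : ℕ
      cardP    : card P ≡ 2 ^ a
      orderH   : order ≡ 2 ^ a * m
      m-odd    : ¬ (2 ∣ m)

  Stable : (El → El) → Subset → Set
  Stable σ P = (∀ x → x ∈ P → σ x ∈ P) × (∀ y → y ∈ P → Σ El λ x → x ∈ P × σ x ≡ y)

  -- The semidirect product H ⋊_θ Z₂, θ(x) = τ; elements (k , b) with b = true meaning x.
  module SemiDirect (τ : El → El) where
    θ : Bool → El → El
    θ false k = k
    θ true  k = τ k

    SD : Set
    SD = El × Bool

    _⊙_ : SD → SD → SD
    (k₁ , a) ⊙ (k₂ , b) = (k₁ · θ a k₂) , (a xor b)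

    sdinv : SD → SD
    sdinv (k , a) = θ a (inv k) , a

    conj : SD → SD → SD
    conj c g = (c ⊙ g) ⊙ sdinv c

    eqᵇ : El → El → Bool
    eqᵇ x y = ⌊ x ≟ y ⌋

    -- For a τ-stable subgroup K (given by K : Subset), the subgroup K ⋊ Z₂ of H ⋊ Z₂.
    -- S(K,τ): elements (k , x) with k ∈ K and (k , x)² = e, i.e. k · τ k = e.
    inSᵇ : Subset → El → Bool
    inSᵇ K k = K k ∧ eqᵇ (proj₁ ((k , true) ⊙ (k , true))) e

    -- (k , x) ∈ S is the canonical (toℕ-minimal) representative of its
    -- conjugacy class in K ⋊ Z₂: no conjugate (by an element of K ⋊ Z₂) has
    -- a smaller first component.  (Conjugates of elements of S lie in S.)
    isRepᵇ : Subset → El → Bool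
    isRepᵇ K k = inSᵇ K k ∧
      all (λ h → if K h
                 then all (λ b → toℕ k ≤ᵇ toℕ (proj₁ (conj (h , b) (k , true))))
                          (true Data.List.∷ false Data.List.∷ Data.List.[])
                 else true)
          (allFinL order)

  -- 𝒢_TF(K, τ|_K): number of conjugacy classes of K ⋊ Z₂ contained in S(K, τ|_K)
  GTF : (τ : El → El) → Subset → ℕ
  GTF τ K = length (filter (λ k → isRepᵇ K k Data.Bool.≟ true) (allFinL order))
    where open SemiDirect τ

  whole : Subset
  whole _ = true

{-# OPTIONS --safe #-}

-- Everything rests on the parity argument "an involution of a finite set moves an even
-- number of points", applied to coset spaces.
--
-- Let Q be a σ-stable 2-subgroup of even index. The fixed points of Q on H/Q form N(Q)/Q,
-- which has even order because Q is built by successive extensions of index 2. Applying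
-- the parity argument to σ and then to inversion gives a nontrivial coset hQ in N(Q)/Q
-- with σ(h)Q = hQ and h² ∈ Q, and Q ∪ hQ is a σ-stable 2-subgroup twice as large.
-- Iterating yields a σ-stable Sylow 2-subgroup P.
--
-- If (k , x) is an involution then aP ↦ kσ(a)P is an involution of the odd set H/P, so it
-- fixes some aP, and a⁻¹ (k , x) a lies in P ⋊ Z₂. Hence every class of S(H, σ) meets
-- S(P, σ), which bounds the number of classes.

module Submission where

open import Defs
open import Data.Bool using (Bool; true; false; not; _∧_; _∨_; T; if_then_else_)
open import Data.Bool.ListAction using (all)
open import Data.Bool.Properties using (∨-zeroʳ; T-≡) renaming (_≟_ to _≟ᵇ_)
open import Data.Fin using (Fin; zero; suc; toℕ)
open import Data.Fin.Patterns using (0F; 1F; 2F; 3F)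
open import Data.Fin.Properties using (_≟_; toℕ-injective; suc-injective; all?; any?)
open import Data.List using (List; []; _∷_; filter; length; tabulate)
open import Data.Nat
  using (ℕ; zero; suc; _+_; _*_; _^_; _≤_; _<_; _≤ᵇ_; _<?_; z≤n; s≤s; >-nonZero)
open import Data.Nat.Divisibility using (_∣_; divides; ∣m+n∣m⇒∣n; n∣m*n; ∣1⇒≡1; _∣?_)
open import Data.Nat.Properties
  using (≤-refl; ≤-reflexive; ≤-trans; ≤-antisym; ≤-pred; ≤∧≢⇒<; <-asym; ≮⇒≥; 1+n≰n;
         ≤ᵇ⇒≤; ≤⇒≤ᵇ; m≤n⇒m≤o+n; m<m*n; m^n≢0; +-identityʳ; +-comm; +-mono-≤; *-comm; *-assoc;
         *-cancelʳ-≡; +-0-commutativeMonoid; +-*-semiring; module ≤-Reasoning)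
open import Data.Product using (Σ; ∃; _×_; _,_; proj₁; proj₂)
open import Data.Sum using (_⊎_; inj₁; inj₂)
open import Data.Unit using (tt)
open import Data.Vec using (Vec; lookup; []; _∷_)
open import Function using (_∘_; id; Equivalence)
open import Level using (0ℓ)
open import Relation.Binary.PropositionalEquality
open import Relation.Nullary using (¬_; Dec; yes; no; does; contradiction)
open import Relation.Nullary.Decidable using (_×-dec_; _→-dec_; ¬?; decidable-stable; ⌊_⌋)
open import Relation.Unary using (Pred; Decidable)
open import Relation.Unary.Properties using (U?)
open import Algebra.Properties.CommutativeMonoid.Sum +-0-commutativeMonoid
  using (sum; sum-cong-≗; ∑-comm; ∑-distrib-+)
open import Algebra.Properties.Semiring.Sum +-*-semiring using (*-distribʳ-sum)

-- Counting in Fin n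

private variable m n : ℕ

𝟙 : {A : Set} → Dec A → ℕ
𝟙 d = if does d then 1 else 0

count : {P : Pred (Fin n) 0ℓ} → Decidable P → ℕ
count P? = sum λ i → 𝟙 (P? i)

sum-mono : (f g : Fin n → ℕ) → (∀ i → f i ≤ g i) → sum f ≤ sum g
sum-mono {n = zero}  f g f≤g = z≤n
sum-mono {n = suc n} f g f≤g = +-mono-≤ (f≤g zero) (sum-mono (f ∘ suc) (g ∘ suc) (f≤g ∘ suc))

count-none : {P : Pred (Fin n) 0ℓ} (P? : Decidable P) → (∀ i → ¬ P i) → count P? ≡ 0
count-none {n = zero}  P? none = refl
count-none {n = suc n} P? none with P? zero
... | yes p = contradiction p (none zero)
... | no _  = count-none (P? ∘ suc) (none ∘ suc)

count-some : {P : Pred (Fin n) 0ℓ} (P? : Decidable P) → ∃ P → 1 ≤ count P?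
count-some P? (zero , p) with P? zero
... | yes _ = s≤s z≤n
... | no ¬p = contradiction p ¬p
count-some P? (suc i , p) = m≤n⇒m≤o+n (𝟙 (P? zero)) (count-some (P? ∘ suc) (i , p))

count-unique : {P : Pred (Fin n) 0ℓ} (P? : Decidable P) →
               (∀ i j → P i → P j → i ≡ j) → count P? ≤ 1
count-unique {n = zero}  P? unique = z≤n
count-unique {n = suc n} P? unique with P? zero
... | yes p = s≤s (≤-reflexive (count-none (P? ∘ suc) λ i q → contradiction (unique zero (suc i) p q) λ ()))
... | no _  = count-unique (P? ∘ suc) λ i j p q → suc-injective (unique (suc i) (suc j) p q)

-- Double counting of the pairs `(a , b)` satisfying `P`, `Q` and `R`: each `a` in `P` occurs at
-- least once, each `b` in `Q` at most once. A relation is allowed in place of a map so that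
-- conjugacy itself can serve as `R`.
count-≤ : {P : Pred (Fin m) 0ℓ} {Q : Pred (Fin n) 0ℓ} {R : Fin m → Fin n → Set}
          (P? : Decidable P) (Q? : Decidable Q) (R? : ∀ a b → Dec (R a b)) →
          (∀ a → P a → ∃ λ b → Q b × R a b) →
          (∀ {a a′ b} → P a → P a′ → R a b → R a′ b → a ≡ a′) →
          count P? ≤ count Q?
count-≤ {P = P} {Q} {R} P? Q? R? total injective = begin
  count P?                              ≤⟨ sum-mono _ _ out ⟩
  sum (λ a → count (λ b → T? a b))      ≡⟨ ∑-comm (λ a b → 𝟙 (T? a b)) ⟩
  sum (λ b → count (λ a → T? a b))      ≤⟨ sum-mono _ _ into ⟩
  count Q?                              ∎
  where
  open ≤-Reasoning
  T? : ∀ a b → Dec (P a × Q b × R a b)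
  T? a b = P? a ×-dec (Q? b ×-dec R? a b)
  out : ∀ a → 𝟙 (P? a) ≤ count (T? a)
  out a = go (P? a)
    where
    go : (d : Dec (P a)) → 𝟙 d ≤ count (T? a)
    go (no _)  = z≤n
    go (yes p) = let b , q , r = total a p in count-some (T? a) (b , p , q , r)
  into : ∀ b → count (λ a → T? a b) ≤ 𝟙 (Q? b)
  into b = go (Q? b)
    where
    go : (d : Dec (Q b)) → count (λ a → T? a b) ≤ 𝟙 d
    go (no ¬q) = ≤-reflexive (count-none (λ a → T? a b) λ _ (_ , q , _) → ¬q q)
    go (yes _) = count-unique (λ a → T? a b) λ _ _ (p , _ , r) (p′ , _ , r′) → injective p p′ r r′

count-≡ : {P : Pred (Fin m) 0ℓ} {Q : Pred (Fin n) 0ℓ} (P? : Decidable P) (Q? : Decidable Q)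
          (f : Fin m → Fin n) (g : Fin n → Fin m) →
          (∀ a → P a → Q (f a) × g (f a) ≡ a) → (∀ b → Q b → P (g b) × f (g b) ≡ b) →
          count P? ≡ count Q?
count-≡ P? Q? f g to from = ≤-antisym
  (count-≤ P? Q? (λ a b → f a ≟ b) (λ a p → f a , proj₁ (to a p) , refl)
    λ p p′ r r′ → trans (sym (proj₂ (to _ p))) (trans (cong g (trans r (sym r′))) (proj₂ (to _ p′))))
  (count-≤ Q? P? (λ b a → g b ≟ a) (λ b q → g b , proj₁ (from b q) , refl)
    λ q q′ r r′ → trans (sym (proj₂ (from _ q))) (trans (cong f (trans r (sym r′))) (proj₂ (from _ q′))))

count-⇔ : {P Q : Pred (Fin n) 0ℓ} (P? : Decidable P) (Q? : Decidable Q) →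
          (∀ {a} → P a → Q a) → (∀ {a} → Q a → P a) → count P? ≡ count Q?
count-⇔ P? Q? to from = count-≡ P? Q? id id (λ _ p → to p , refl) (λ _ q → from q , refl)

count-split : {P C : Pred (Fin n) 0ℓ} (P? : Decidable P) (C? : Decidable C) →
              count P? ≡ count (λ a → P? a ×-dec C? a) + count (λ a → P? a ×-dec ¬? (C? a))
count-split P? C? = trans (sum-cong-≗ λ a → split (P? a) (C? a))
  (∑-distrib-+ (λ a → 𝟙 (P? a ×-dec C? a)) (λ a → 𝟙 (P? a ×-dec ¬? (C? a))))
  where
  split : {A B : Set} (A? : Dec A) (B? : Dec B) → 𝟙 A? ≡ 𝟙 (A? ×-dec B?) + 𝟙 (A? ×-dec ¬? B?)
  split (no _)  (yes _) = refl
  split (no _)  (no _)  = refl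
  split (yes _) (yes _) = refl
  split (yes _) (no _)  = refl

length-filter : (A : Fin n → Bool) {k : ℕ} (f : Fin k → Fin n) →
                length (filter (λ x → A x ≟ᵇ true) (tabulate f)) ≡ count (λ i → A (f i) ≟ᵇ true)
length-filter A {zero}  f = refl
length-filter A {suc k} f with does (A (f zero) ≟ᵇ true)
... | true  = cong suc (length-filter A (f ∘ suc))
... | false = length-filter A (f ∘ suc)

-- The points moved up by the involution f correspond under f to those moved down.
count-involution : {P : Pred (Fin n) 0ℓ} (P? : Decidable P) (f : Fin n → Fin n) →
                   (∀ a → P a → P (f a)) → (∀ a → P a → f (f a) ≡ a) →
                   ∃ λ k → count P? ≡ count (λ a → P? a ×-dec (f a ≟ a)) + k * 2
count-involution {P = P} P? f closed invol = count up? , (begin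
  count P?                               ≡⟨ count-split P? fixed? ⟩
  count still? + count moved?            ≡⟨ cong (count still? +_) (count-split moved? less?) ⟩
  count still? + (count up? + count down?)
    ≡⟨ cong (λ d → count still? + (count up? + d)) (trans swap (sym (+-identityʳ _))) ⟩
  count still? + 2 * count up?           ≡⟨ cong (count still? +_) (*-comm 2 (count up?)) ⟩
  count still? + count up? * 2           ∎)
  where
  open ≡-Reasoning
  fixed? = λ a → f a ≟ a
  less?  = λ a → toℕ a <? toℕ (f a)
  still? = λ a → P? a ×-dec fixed? a
  moved? = λ a → P? a ×-dec ¬? (fixed? a)
  up?    = λ a → moved? a ×-dec less? a
  down?  = λ a → moved? a ×-dec ¬? (less? a)
  swap : count down? ≡ count up?
  swap = count-≡ down? up? f f
    (λ a ((p , ≢) , ≮) → ((closed a p , λ e → ≢ (trans (sym e) (invol a p)))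
       , subst (λ z → suc (toℕ (f a)) ≤ toℕ z) (sym (invol a p))
           (≤∧≢⇒< (≮⇒≥ ≮) (≢ ∘ toℕ-injective))) , invol a p)
    (λ a ((p , ≢) , lt) → ((closed a p , λ e → ≢ (trans (sym e) (invol a p)))
       , λ gt → <-asym lt (subst (λ z → suc (toℕ (f a)) ≤ toℕ z) (invol a p) gt)) , invol a p)

least : {P : Pred (Fin n) 0ℓ} → Decidable P → ∃ P → ∃ λ i → P i × (∀ j → P j → toℕ i ≤ toℕ j)
least {n = suc n} P? (i , p) with P? zero
... | yes p₀ = zero , p₀ , λ _ _ → z≤n
least {n = suc n} P? (zero , p)  | no ¬p₀ = contradiction p ¬p₀
least {n = suc n} {P} P? (suc i , p) | no ¬p₀ with least (P? ∘ suc) (i , p)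
... | j , q , min = suc j , q , minimal
  where minimal : ∀ k → P k → suc (toℕ j) ≤ toℕ k
        minimal zero    r = contradiction r ¬p₀
        minimal (suc k) r = s≤s (min k r)

-- Pigeonhole: if `b` were missed, `f` would inject `P` into `P` without `b`, which is smaller by at
-- least one.
count-surjective : {P : Pred (Fin n) 0ℓ} (P? : Decidable P) (f : Fin n → Fin n) →
                   (∀ a → P a → P (f a)) → (∀ {a b} → P a → P b → f a ≡ f b → a ≡ b) →
                   ∀ b → P b → ∃ λ a → P a × f a ≡ b
count-surjective P? f closed injective b p =
  decidable-stable (any? λ a → P? a ×-dec (f a ≟ b)) λ none →
    let is-b?  = λ a → P? a ×-dec (a ≟ b)
        not-b? = λ a → P? a ×-dec ¬? (a ≟ b)
    in 1+n≰n (≤-trans (+-mono-≤ (count-some is-b? (b , p , refl))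
         (count-≤ P? not-b? (λ a c → f a ≟ c)
           (λ a q → f a , (closed a q , λ r → none (a , q , r)) , refl)
           (λ q q′ r r′ → injective q q′ (trans r (sym r′)))))
       (≤-reflexive (sym (count-split P? (_≟ b)))))

-- Boolean reflection

∨-split : ∀ x {y} → x ∨ y ≡ true → x ≡ true ⊎ y ≡ true
∨-split true  _ = inj₁ refl
∨-split false p = inj₂ p

∧-split : ∀ x {y} → x ∧ y ≡ true → x ≡ true × y ≡ true
∧-split true p = refl , p

all-tabulate⁻ : {A : Set} {n : ℕ} (p : A → Bool) (f : Fin n → A) →
                all p (tabulate f) ≡ true → ∀ i → p (f i) ≡ true
all-tabulate⁻ p f eq zero    = proj₁ (∧-split _ eq)
all-tabulate⁻ p f eq (suc i) = all-tabulate⁻ p (f ∘ suc) (proj₂ (∧-split _ eq)) i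

all-tabulate⁺ : {A : Set} {n : ℕ} (p : A → Bool) (f : Fin n → A) →
                (∀ i → p (f i) ≡ true) → all p (tabulate f) ≡ true
all-tabulate⁺ {n = zero}  p f ptrue = refl
all-tabulate⁺ {n = suc n} p f ptrue = cong₂ _∧_ (ptrue zero) (all-tabulate⁺ p (f ∘ suc) (ptrue ∘ suc))

isYes⇒ : {A : Set} (d : Dec A) → ⌊ d ⌋ ≡ true → A
isYes⇒ (yes a) _ = a

⇒isYes : {A : Set} (d : Dec A) → A → ⌊ d ⌋ ≡ true
⇒isYes (yes _) _ = refl
⇒isYes (no ¬a) a = contradiction a ¬a

-- Normalisation of words in the free group

infix 9 _′
infixl 8 _⊕_
data Expr (v : ℕ) : Set where
  var : Fin v → Expr v
  one : Expr v
  _⊕_ : Expr v → Expr v → Expr v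
  _′  : Expr v → Expr v

pattern 𝐚 = var 0F
pattern 𝐛 = var 1F
pattern 𝐜 = var 2F
pattern 𝐝 = var 3F

Word : ℕ → Set
Word v = List (Bool × Fin v)

push : ∀ {v} → Bool × Fin v → Word v → Word v
push l [] = l ∷ []
push (b , i) ((c , j) ∷ w) with i ≟ j | b ≟ᵇ not c
... | yes _ | yes _ = w
... | _     | _     = (b , i) ∷ (c , j) ∷ w

-- `w` is an accumulator: the results stand for `a` times `w` and for the inverse of `a` times `w`.
-- Inverses thus descend to the letters, and every letter enters through the cancelling `push`.
reduce reduce⁻ : ∀ {v} → Expr v → Word v → Word v
reduce (var i) w = push (true , i) w
reduce one     w = w
reduce (a ⊕ b) w = reduce a (reduce b w)
reduce (a ′)   w = reduce⁻ a w
reduce⁻ (var i) w = push (false , i) w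
reduce⁻ one     w = w
reduce⁻ (a ⊕ b) w = reduce⁻ b (reduce⁻ a w)
reduce⁻ (a ′)   w = reduce a w

-- Group identities by comparison of reduced words

module FinGroupTheory (H : FinGroup) where
  open FinGroup H renaming (_·_ to infixl 7 _∙_; inv to infix 8 _⁻¹)
  private G = El H

  unique⁻¹ : ∀ x y → x ∙ y ≡ e → x ≡ y ⁻¹
  unique⁻¹ x y xy≡e = begin
    x               ≡⟨ identityʳ x ⟨
    x ∙ e           ≡⟨ cong (x ∙_) (inverseʳ y) ⟨
    x ∙ (y ∙ y ⁻¹)  ≡⟨ assoc x y _ ⟨
    x ∙ y ∙ y ⁻¹    ≡⟨ cong (_∙ y ⁻¹) xy≡e ⟩
    e ∙ y ⁻¹        ≡⟨ identityˡ _ ⟩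
    y ⁻¹            ∎
    where open ≡-Reasoning

  module Solver {v} (ρ : Vec G v) where
    ⟦_⟧ : Expr v → G
    ⟦ var i ⟧ = lookup ρ i
    ⟦ one ⟧   = e
    ⟦ a ⊕ b ⟧ = ⟦ a ⟧ ∙ ⟦ b ⟧
    ⟦ a ′ ⟧   = ⟦ a ⟧ ⁻¹

    letter : Bool × Fin v → G
    letter (true  , i) = lookup ρ i
    letter (false , i) = lookup ρ i ⁻¹

    ⟦_⟧ʷ : Word v → G
    ⟦ [] ⟧ʷ    = e
    ⟦ l ∷ w ⟧ʷ = letter l ∙ ⟦ w ⟧ʷ

    cancel : ∀ c i w → letter (not c , i) ∙ (letter (c , i) ∙ w) ≡ w
    cancel true  i w = trans (sym (assoc _ _ w)) (trans (cong (_∙ w) (inverseˡ _)) (identityˡ w))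
    cancel false i w = trans (sym (assoc _ _ w)) (trans (cong (_∙ w) (inverseʳ _)) (identityˡ w))

    push-sound : ∀ l w → ⟦ push l w ⟧ʷ ≡ letter l ∙ ⟦ w ⟧ʷ
    push-sound l [] = refl
    push-sound (b , i) ((c , j) ∷ w) with i ≟ j | b ≟ᵇ not c
    ... | yes refl | yes refl = sym (cancel c i ⟦ w ⟧ʷ)
    ... | yes _    | no _     = refl
    ... | no _     | _        = refl

    reduce-sound : ∀ a w → ⟦ reduce a w ⟧ʷ ≡ ⟦ a ⟧ ∙ ⟦ w ⟧ʷ
    reduce⁻-sound : ∀ a w → ⟦ reduce⁻ a w ⟧ʷ ≡ ⟦ a ⟧ ⁻¹ ∙ ⟦ w ⟧ʷ
    reduce-sound (var i) w = push-sound (true , i) w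
    reduce-sound one     w = sym (identityˡ _)
    reduce-sound (a ⊕ b) w = trans (reduce-sound a _)
      (trans (cong (⟦ a ⟧ ∙_) (reduce-sound b w)) (sym (assoc _ _ _)))
    reduce-sound (a ′)   w = reduce⁻-sound a w
    reduce⁻-sound (var i) w = push-sound (false , i) w
    reduce⁻-sound one     w =
      sym (trans (cong (_∙ ⟦ w ⟧ʷ) (sym (unique⁻¹ e e (identityˡ e)))) (identityˡ _))
    reduce⁻-sound (a ⊕ b) w = trans (reduce⁻-sound b _)
      (trans (cong (⟦ b ⟧ ⁻¹ ∙_) (reduce⁻-sound a w))
      (trans (sym (assoc _ _ _)) (cong (_∙ ⟦ w ⟧ʷ) (unique⁻¹ _ _ anti))))
      where
      open ≡-Reasoning
      x = ⟦ a ⟧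
      y = ⟦ b ⟧
      anti : y ⁻¹ ∙ x ⁻¹ ∙ (x ∙ y) ≡ e
      anti = begin
        y ⁻¹ ∙ x ⁻¹ ∙ (x ∙ y)    ≡⟨ assoc _ _ _ ⟩
        y ⁻¹ ∙ (x ⁻¹ ∙ (x ∙ y))  ≡⟨ cong (y ⁻¹ ∙_) (assoc _ _ _) ⟨
        y ⁻¹ ∙ (x ⁻¹ ∙ x ∙ y)    ≡⟨ cong (λ z → y ⁻¹ ∙ (z ∙ y)) (inverseˡ x) ⟩
        y ⁻¹ ∙ (e ∙ y)           ≡⟨ cong (y ⁻¹ ∙_) (identityˡ y) ⟩
        y ⁻¹ ∙ y                 ≡⟨ inverseˡ y ⟩
        e                        ∎
    reduce⁻-sound (a ′) w =
      trans (reduce-sound a w) (cong (_∙ ⟦ w ⟧ʷ) (unique⁻¹ _ _ (inverseʳ _)))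

    -- Both expressions have the value of their common reduced word. The entries of `ρ` are
    -- arbitrary elements, so terms such as `σ h` can be letters.
    solve : ∀ a b → reduce a [] ≡ reduce b [] → ⟦ a ⟧ ≡ ⟦ b ⟧
    solve a b eq = begin
      ⟦ a ⟧               ≡⟨ identityʳ _ ⟨
      ⟦ a ⟧ ∙ e           ≡⟨ reduce-sound a [] ⟨
      ⟦ reduce a [] ⟧ʷ    ≡⟨ cong ⟦_⟧ʷ eq ⟩
      ⟦ reduce b [] ⟧ʷ    ≡⟨ reduce-sound b [] ⟩
      ⟦ b ⟧ ∙ e           ≡⟨ identityʳ _ ⟩
      ⟦ b ⟧               ∎
      where open ≡-Reasoning

  open Solver using (solve)

  -- Cosets of subgroups

  module Cosets {K : Subset H} (subgroup : IsSubgroup H K) where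
    open IsSubgroup subgroup public

    infix 4 _∈K _~_ _~?_
    _∈K : G → Set
    x ∈K = K x ≡ true

    _~_ : G → G → Set
    x ~ y = (x ⁻¹ ∙ y) ∈K

    _~?_ : ∀ x y → Dec (x ~ y)
    x ~? y = K (x ⁻¹ ∙ y) ≟ᵇ true

    ∈-≡ : ∀ {x y} → x ≡ y → y ∈K → x ∈K
    ∈-≡ refl p = p

    ~-refl : ∀ {x} → x ~ x
    ~-refl = ∈-≡ (inverseˡ _) e∈

    ~-sym : ∀ {x y} → x ~ y → y ~ x
    ~-sym {x} {y} p = ∈-≡ (solve (x ∷ y ∷ []) (𝐛 ′ ⊕ 𝐚) ((𝐚 ′ ⊕ 𝐛) ′) refl) (inv∈ _ p)

    ~-trans : ∀ {x y z} → x ~ y → y ~ z → x ~ z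
    ~-trans {x} {y} {z} p q =
      ∈-≡ (solve (x ∷ y ∷ z ∷ []) (𝐚 ′ ⊕ 𝐜) (𝐚 ′ ⊕ 𝐛 ⊕ (𝐛 ′ ⊕ 𝐜)) refl) (·∈ _ _ p q)

    translate-~ : ∀ g {x y} → x ~ y → g ∙ x ~ g ∙ y
    translate-~ g {x} {y} =
      ∈-≡ (solve (g ∷ x ∷ y ∷ []) ((𝐚 ⊕ 𝐛) ′ ⊕ (𝐚 ⊕ 𝐜)) (𝐛 ′ ⊕ 𝐜) refl)

    rep : G → G
    rep x = proj₁ (least (x ~?_) (x , ~-refl))

    ~-rep : ∀ x → x ~ rep x
    ~-rep x = proj₁ (proj₂ (least (x ~?_) (x , ~-refl)))

    rep-least : ∀ x y → x ~ y → toℕ (rep x) ≤ toℕ y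
    rep-least x = proj₂ (proj₂ (least (x ~?_) (x , ~-refl)))

    rep-cong : ∀ {x y} → x ~ y → rep x ≡ rep y
    rep-cong {x} {y} p = toℕ-injective (≤-antisym
      (rep-least x _ (~-trans p (~-rep y)))
      (rep-least y _ (~-trans (~-sym p) (~-rep x))))

    rep≡⇒~ : ∀ {x y} → rep x ≡ y → x ~ y
    rep≡⇒~ refl = ~-rep _

    -- Cosets are counted by their toℕ-least elements; P is meant to be a union of cosets.
    cosets : {P : Pred G 0ℓ} → Decidable P → ℕ
    cosets P? = count λ x → (rep x ≟ x) ×-dec P? x

    cosets-⇔ : {P Q : Pred G 0ℓ} (P? : Decidable P) (Q? : Decidable Q) →
               (∀ {x} → P x → Q x) → (∀ {x} → Q x → P x) → cosets P? ≡ cosets Q?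
    cosets-⇔ P? Q? to from = count-⇔ (λ x → (rep x ≟ x) ×-dec P? x) (λ x → (rep x ≟ x) ×-dec Q? x)
      (λ (r , p) → r , to p) (λ (r , q) → r , from q)

    index : ℕ
    index = cosets U?

    -- `f` is an involution only up to `_~_`, but `rep ∘ f` is a genuine one on the least
    -- representatives. For such an `x`, `rep (f x) ≡ x` holds exactly when `f x ~ x`.
    cosets-involution :
      {P : Pred G 0ℓ} (P? : Decidable P) (f : G → G) →
      (∀ {x y} → x ~ y → P x → P y) → (∀ {x y} → P x → x ~ y → f x ~ f y) →
      (∀ {x} → P x → P (f x)) → (∀ {x} → P x → f (f x) ~ x) →
      ∃ λ k → cosets P? ≡ cosets (λ x → P? x ×-dec (f x ~? x)) + k * 2
    cosets-involution {P} P? f P-resp f-resp closed invol =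
      let k , eq = count-involution (λ x → (rep x ≟ x) ×-dec P? x) (rep ∘ f)
            (λ x (_ , p) → sym (rep-cong (~-rep (f x))) , P-resp (~-rep (f x)) (closed p))
            (λ x (r , p) → trans (rep-cong (~-trans (~-sym (f-resp (closed p) (~-rep (f x)))) (invol p))) r)
      in k , trans eq (cong (_+ k * 2) (count-⇔
           (λ x → ((rep x ≟ x) ×-dec P? x) ×-dec (rep (f x) ≟ x))
           (λ x → (rep x ≟ x) ×-dec (P? x ×-dec (f x ~? x)))
           (λ ((r , p) , q) → r , p , rep≡⇒~ q)
           (λ (r , p , q) → (r , p) , trans (rep-cong q) r)))

    card≡count : card H K ≡ count (λ x → K x ≟ᵇ true)
    card≡count = length-filter K id

    -- The fibre of `rep` over `x` is empty unless `x` represents its own coset; then left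
    -- multiplication by `x` is a bijection from `K` onto it.
    coset-size : ∀ x → count (λ a → rep a ≟ x) ≡ 𝟙 (rep x ≟ x) * card H K
    coset-size x with rep x ≟ x
    ... | no r≢ = count-none (λ a → rep a ≟ x) λ a r →
                    r≢ (trans (cong rep (sym r)) (trans (sym (rep-cong (~-rep a))) r))
    ... | yes r = trans (count-≡ (λ a → rep a ≟ x) (λ k → K k ≟ᵇ true) (x ⁻¹ ∙_) (x ∙_)
        (λ a s → ~-sym (rep≡⇒~ s) , solve (x ∷ a ∷ []) (𝐚 ⊕ (𝐚 ′ ⊕ 𝐛)) 𝐛 refl)
        (λ k k∈ → trans (rep-cong (~-sym (∈-≡ (eq k) k∈))) r , eq k))
      (trans (sym card≡count) (sym (+-identityʳ _)))
      where eq : ∀ k → x ⁻¹ ∙ (x ∙ k) ≡ k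
            eq k = solve (x ∷ k ∷ []) (𝐚 ′ ⊕ (𝐚 ⊕ 𝐛)) 𝐛 refl

    -- The pairs `(a , rep a)` are counted in two ways: one for each `a`, and by fibres over the
    -- representatives.
    lagrange : order ≡ index * card H K
    lagrange = begin
      order                                             ≡⟨ count-all order ⟨
      sum (λ (a : G) → 1)                               ≡⟨ sum-cong-≗ one-rep ⟨
      sum (λ a → count (λ x → rep a ≟ x))               ≡⟨ ∑-comm (λ a x → 𝟙 (rep a ≟ x)) ⟩
      sum (λ x → count (λ a → rep a ≟ x))               ≡⟨ sum-cong-≗ coset-size ⟩
      sum (λ x → 𝟙 (rep x ≟ x) * card H K)              ≡⟨ *-distribʳ-sum (card H K) (λ x → 𝟙 (rep x ≟ x)) ⟨
      sum (λ x → 𝟙 (rep x ≟ x)) * card H K              ≡⟨ cong (_* card H K) (count-⇔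
        (λ x → rep x ≟ x) (λ x → (rep x ≟ x) ×-dec U? x) (_, tt) proj₁) ⟩
      index * card H K                                  ∎
      where
      open ≡-Reasoning
      count-all : ∀ n → sum {n} (λ _ → 1) ≡ n
      count-all zero    = refl
      count-all (suc n) = cong suc (count-all n)
      one-rep : ∀ a → count (λ x → rep a ≟ x) ≡ 1
      one-rep a = ≤-antisym
        (count-unique (λ x → rep a ≟ x) λ i j p q → trans (sym p) q)
        (count-some (λ x → rep a ≟ x) (rep a , refl))

  -- Parity of fixed cosets

  module CosetParity {K : Subset H} (subgroup : IsSubgroup H K) where
    open Cosets subgroup

    even-fixed :
      {P : Pred G 0ℓ} (P? : Decidable P) (f : G → G) →
      (∀ {x y} → x ~ y → P x → P y) → (∀ {x y} → P x → x ~ y → f x ~ f y) →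
      (∀ {x} → P x → P (f x)) → (∀ {x} → P x → f (f x) ~ x) →
      2 ∣ cosets P? → 2 ∣ cosets (λ x → P? x ×-dec (f x ~? x))
    even-fixed P? f P-resp f-resp closed invol even =
      let k , eq = cosets-involution P? f P-resp f-resp closed invol
      in ∣m+n∣m⇒∣n (subst (2 ∣_) (trans eq (+-comm _ (k * 2))) even) (n∣m*n k)

    odd-fixed : (f : G → G) → (∀ {x y} → x ~ y → f x ~ f y) → (∀ x → f (f x) ~ x) →
                ¬ 2 ∣ index → ∃ λ x → f x ~ x
    odd-fixed f f-resp invol odd = decidable-stable (any? λ x → f x ~? x) λ none →
      let k , eq = cosets-involution U? f (λ _ _ → tt) (λ _ → f-resp) (λ _ → tt) (λ {x} _ → invol x)
      in odd (divides k (trans eq (cong (_+ k * 2)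
           (count-none (λ x → (rep x ≟ x) ×-dec (U? x ×-dec (f x ~? x))) λ x (_ , _ , p) → none (x , p)))))

    -- `K` itself is one of the cosets counted, and an even number is not 1, so there is another.
    even-nontrivial : {P : Pred G 0ℓ} (P? : Decidable P) → (∀ {x y} → x ~ y → P x → P y) →
                      P e → 2 ∣ cosets P? → ∃ λ x → P x × ¬ x ∈K
    even-nontrivial {P} P? P-resp Pe even =
      decidable-stable (any? λ x → P? x ×-dec ¬? (K x ≟ᵇ true)) λ none →
        let trivial : ∀ x → P x → e ~ x
            trivial x p = decidable-stable (e ~? x) λ ¬q →
              none (x , p , λ q → ¬q (∈-≡ (solve (x ∷ []) (one ′ ⊕ 𝐚) 𝐚 refl) q))
            T? = λ x → (rep x ≟ x) ×-dec P? x
            one-coset : cosets P? ≡ 1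
            one-coset = ≤-antisym
              (count-unique T? λ x y (r , p) (s , q) →
                trans (sym r) (trans (rep-cong (~-trans (~-sym (trivial x p)) (trivial y q))) s))
              (count-some T? (rep e , sym (rep-cong (~-rep e)) , P-resp (~-rep e) Pe))
        in contradiction (∣1⇒≡1 (subst (2 ∣_) one-coset even)) λ ()

  -- The coset xR is a fixed point of `Q` acting on H/R by left multiplication: qxR = xR means that
  -- the conjugate of q by x lies in `R`. For `R` equal to a subgroup `Q` this is the normaliser of
  -- `Q`, by finiteness.
  Fixes : Subset H → Subset H → Pred G 0ℓ
  Fixes Q R x = ∀ q → Q q ≡ true → R (x ⁻¹ ∙ q ∙ x) ≡ true

  fixes? : ∀ Q R → Decidable (Fixes Q R)
  fixes? Q R x = all? λ q → (Q q ≟ᵇ true) →-dec (R (x ⁻¹ ∙ q ∙ x) ≟ᵇ true)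

  Fixes-resp : ∀ {Q R} (sub : IsSubgroup H R) → let open Cosets sub in
               ∀ {x y} → x ~ y → Fixes Q R x → Fixes Q R y
  Fixes-resp sub {x} {y} x~y fix q q∈ =
    ∈-≡ (solve (x ∷ y ∷ q ∷ []) (𝐛 ′ ⊕ 𝐜 ⊕ 𝐛) (𝐛 ′ ⊕ 𝐚 ⊕ (𝐚 ′ ⊕ 𝐜 ⊕ 𝐚) ⊕ (𝐚 ′ ⊕ 𝐛)) refl)
      (·∈ _ _ (·∈ _ _ (~-sym x~y) (fix q q∈)) x~y)
    where open Cosets sub

  -- What is needed of the congruence |X^Q| ≡ |X| mod 2 for a 2-group Q, with X = H/R.
  FixParity : Subset H → Set
  FixParity Q = ∀ {R} (sub : IsSubgroup H R) →
                2 ∣ Cosets.index sub → 2 ∣ Cosets.cosets sub (fixes? Q R)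

  -- Extending a 2-subgroup

  adjoin : G → Subset H → Subset H
  adjoin h Q z = Q z ∨ Q (h ⁻¹ ∙ z)

  module Adjoin {Q : Subset H} (sub : IsSubgroup H Q) (h : G)
                (h∉ : ¬ Q h ≡ true) (normalizes : Fixes Q Q h) (h²∈ : Q (h ∙ h) ≡ true) where
    open Cosets sub

    Q′ : Subset H
    Q′ = adjoin h Q

    ∈ˡ : ∀ {z} → z ∈K → Q′ z ≡ true
    ∈ˡ {z} p = cong (_∨ Q (h ⁻¹ ∙ z)) p

    ∈ʳ : ∀ {z} → h ~ z → Q′ z ≡ true
    ∈ʳ {z} p = trans (cong (Q z ∨_) p) (∨-zeroʳ (Q z))

    h∈ : Q′ h ≡ true
    h∈ = ∈ʳ ~-refl

    -- Moving `h` to the left past an element q of `Q` replaces q by `h ⁻¹ ∙ q ∙ h`, again in `Q`. A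
    -- product of two elements of hQ then begins with `h ∙ h`, which is in `Q`.
    adjoin-subgroup : IsSubgroup H Q′
    adjoin-subgroup = record { e∈ = ∈ˡ e∈ ; ·∈ = mul ; inv∈ = inverse }
      where
      mul : ∀ x y → Q′ x ≡ true → Q′ y ≡ true → Q′ (x ∙ y) ≡ true
      mul x y p q with ∨-split (Q x) p | ∨-split (Q y) q
      ... | inj₁ x∈ | inj₁ y∈ = ∈ˡ (·∈ x y x∈ y∈)
      ... | inj₁ x∈ | inj₂ y∈ = ∈ʳ (∈-≡
        (solve (h ∷ x ∷ y ∷ []) (𝐚 ′ ⊕ (𝐛 ⊕ 𝐜)) (𝐚 ′ ⊕ 𝐛 ⊕ 𝐚 ⊕ (𝐚 ′ ⊕ 𝐜)) refl)
        (·∈ _ _ (normalizes x x∈) y∈))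
      ... | inj₂ x∈ | inj₁ y∈ = ∈ʳ (∈-≡ (sym (assoc _ x y)) (·∈ _ _ x∈ y∈))
      ... | inj₂ x∈ | inj₂ y∈ = ∈ˡ (∈-≡
        (solve (h ∷ x ∷ y ∷ []) (𝐛 ⊕ 𝐜) (𝐚 ⊕ 𝐚 ⊕ (𝐚 ′ ⊕ (𝐚 ′ ⊕ 𝐛) ⊕ 𝐚) ⊕ (𝐚 ′ ⊕ 𝐜)) refl)
        (·∈ _ _ (·∈ _ _ h²∈ (normalizes _ x∈)) y∈))
      inverse : ∀ x → Q′ x ≡ true → Q′ (x ⁻¹) ≡ true
      inverse x p with ∨-split (Q x) p
      ... | inj₁ x∈ = ∈ˡ (inv∈ x x∈)
      ... | inj₂ x∈ = ∈ʳ (∈-≡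
        (solve (h ∷ x ∷ []) (𝐚 ′ ⊕ 𝐛 ′) (𝐚 ′ ⊕ (𝐚 ′ ⊕ 𝐛) ′ ⊕ 𝐚 ⊕ (𝐚 ⊕ 𝐚) ′) refl)
        (·∈ _ _ (normalizes _ (inv∈ _ x∈)) (inv∈ _ h²∈)))

    -- As `h` is outside `Q`, the coset hQ is disjoint from `Q`; translation by `h` matches the two.
    adjoin-card : card H Q′ ≡ 2 * card H Q
    adjoin-card = begin
      card H Q′                                     ≡⟨ length-filter Q′ id ⟩
      count Q′?                                     ≡⟨ count-split Q′? Q? ⟩
      count (λ z → Q′? z ×-dec Q? z) + count (λ z → Q′? z ×-dec ¬? (Q? z))
        ≡⟨ cong₂ _+_
             (count-⇔ (λ z → Q′? z ×-dec Q? z) Q? proj₂ λ p → ∈ˡ p , p)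
             (count-≡ (λ z → Q′? z ×-dec ¬? (Q? z)) Q? (h ⁻¹ ∙_) (h ∙_)
               (λ z (p , z∉) → outside z (∨-split (Q z) p) z∉ , solve (h ∷ z ∷ []) (𝐚 ⊕ (𝐚 ′ ⊕ 𝐛)) 𝐛 refl)
               (λ q q∈ → (∈ʳ (∈-≡ (eq q) q∈) , λ hq∈ → h∉ (∈-≡
                   (solve (h ∷ q ∷ []) 𝐚 (𝐚 ⊕ 𝐛 ⊕ 𝐛 ′) refl) (·∈ _ _ hq∈ (inv∈ q q∈)))) , eq q)) ⟩
      count Q? + count Q?
        ≡⟨ cong₂ _+_ (sym card≡count) (trans (sym card≡count) (sym (+-identityʳ _))) ⟩
      2 * card H Q                                  ∎
      where
      open ≡-Reasoning
      Q?  = λ z → Q z ≟ᵇ true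
      Q′? = λ z → Q′ z ≟ᵇ true
      outside : ∀ z → z ∈K ⊎ h ~ z → ¬ z ∈K → h ~ z
      outside z (inj₁ p) z∉ = contradiction p z∉
      outside z (inj₂ p) _  = p
      eq : ∀ q → h ⁻¹ ∙ (h ∙ q) ≡ q
      eq q = solve (h ∷ q ∷ []) (𝐚 ′ ⊕ (𝐚 ⊕ 𝐛)) 𝐛 refl

    -- The fixed points of Q′ are those of the involution h acting on the fixed points of Q.
    adjoin-parity : FixParity Q → FixParity Q′
    adjoin-parity parity {R} subR even =
      subst (2 ∣_) (R.cosets-⇔ (λ x → fixes? Q R x ×-dec (h ∙ x R.~? x)) (fixes? Q′ R) to from)
        (CosetParity.even-fixed subR (fixes? Q R) (h ∙_) (Fixes-resp subR) (λ _ → R.translate-~ h)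
          -- Cosets fixed by `Q` are carried to such cosets because `h` normalises `Q`. The next
          -- argument shows that `h` acts on them as an involution, because `h ∙ h` is in `Q`.
          (λ {x} fix q q∈ → R.∈-≡
            (solve (h ∷ x ∷ q ∷ []) ((𝐚 ⊕ 𝐛) ′ ⊕ 𝐜 ⊕ (𝐚 ⊕ 𝐛)) (𝐛 ′ ⊕ (𝐚 ′ ⊕ 𝐜 ⊕ 𝐚) ⊕ 𝐛) refl)
            (fix _ (normalizes q q∈)))
          (λ {x} fix → R.~-sym (R.∈-≡
            (solve (h ∷ x ∷ []) (𝐛 ′ ⊕ (𝐚 ⊕ (𝐚 ⊕ 𝐛))) (𝐛 ′ ⊕ (𝐚 ⊕ 𝐚) ⊕ 𝐛) refl) (fix _ h²∈)))
          (parity subR even))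
      where
      module R = Cosets subR
      to : ∀ {x} → Fixes Q R x × h ∙ x R.~ x → Fixes Q′ R x
      to {x} (fix , hx~x) z z∈ with ∨-split (Q z) z∈
      ... | inj₁ p = fix z p
      ... | inj₂ p = R.∈-≡
        (solve (h ∷ x ∷ z ∷ []) (𝐛 ′ ⊕ 𝐜 ⊕ 𝐛) (𝐛 ′ ⊕ (𝐚 ⊕ 𝐛) ⊕ (𝐛 ′ ⊕ (𝐚 ′ ⊕ 𝐜) ⊕ 𝐛)) refl)
        (R.·∈ _ _ (R.~-sym hx~x) (fix _ p))
      from : ∀ {x} → Fixes Q′ R x → Fixes Q R x × h ∙ x R.~ x
      from {x} fix = (λ q q∈ → fix q (∈ˡ q∈)) ,
        R.~-sym (R.∈-≡ (sym (assoc (x ⁻¹) h x)) (fix h h∈))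

  -- 2-subgroups stable under the involution

  module Involutive (σ : G → G) (aut : InvolutiveAut H σ) where
    open InvolutiveAut aut renaming (inv to σσ)

    σ-e : σ e ≡ e
    σ-e = begin
      σ e                       ≡⟨ solve (σ e ∷ []) 𝐚 (𝐚 ′ ⊕ (𝐚 ⊕ 𝐚)) refl ⟩
      σ e ⁻¹ ∙ (σ e ∙ σ e)      ≡⟨ cong (σ e ⁻¹ ∙_) (trans (sym (hom e e)) (cong σ (identityˡ e))) ⟩
      σ e ⁻¹ ∙ σ e              ≡⟨ inverseˡ (σ e) ⟩
      e                         ∎
      where open ≡-Reasoning

    σ-⁻¹ : ∀ x → σ (x ⁻¹) ≡ σ x ⁻¹
    σ-⁻¹ x = unique⁻¹ _ _ (trans (sym (hom _ x)) (trans (cong σ (inverseˡ x)) σ-e))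

    σ-/ : ∀ x y → σ (x ⁻¹ ∙ y) ≡ σ x ⁻¹ ∙ σ y
    σ-/ x y = trans (hom _ y) (cong (_∙ σ y) (σ-⁻¹ x))

    -- `parity` is an invariant of the construction, proved afresh at each doubling; it supplies the
    -- evenness of N(Q)/Q at the next one.
    record StableTwoSubgroup (Q : Subset H) : Set where
      field
        subgroup : IsSubgroup H Q
        stable   : ∀ x → Q x ≡ true → Q (σ x) ≡ true
        exponent : ℕ
        card≡    : card H Q ≡ 2 ^ exponent
        parity   : FixParity Q

      open Cosets subgroup public

      σ-resp : ∀ {x y} → x ~ y → σ x ~ σ y
      σ-resp {x} {y} p = ∈-≡ (sym (σ-/ x y)) (stable _ p)

    trivial : StableTwoSubgroup λ x → ⌊ x ≟ e ⌋
    trivial = record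
      { subgroup = record
        { e∈   = ⇒isYes (e ≟ e) refl
        ; ·∈   = λ x y p q → ⇒isYes (_ ≟ e)
            (trans (cong₂ _∙_ (isYes⇒ (x ≟ e) p) (isYes⇒ (y ≟ e) q)) (identityˡ e))
        ; inv∈ = λ x p → ⇒isYes (_ ≟ e)
            (trans (cong _⁻¹ (isYes⇒ (x ≟ e) p)) (solve [] (one ′) one refl))
        }
      ; stable   = λ x p → ⇒isYes (_ ≟ e) (trans (cong σ (isYes⇒ (x ≟ e) p)) σ-e)
      ; exponent = 0
      ; card≡    = trans (length-filter (λ (x : G) → ⌊ x ≟ e ⌋) id) (≤-antisym
          (count-unique (λ x → ⌊ x ≟ e ⌋ ≟ᵇ true) λ x y p q → trans (isYes⇒ (x ≟ e) p) (sym (isYes⇒ (y ≟ e) q)))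
          (count-some (λ x → ⌊ x ≟ e ⌋ ≟ᵇ true) (e , ⇒isYes (e ≟ e) refl)))
      -- The trivial group fixes every coset, so the number of fixed cosets is the index.
      ; parity   = λ {R} sub → subst (2 ∣_) (Cosets.cosets-⇔ sub U? (fixes? _ R)
          (λ {x} _ q q≡e → Cosets.∈-≡ sub
            (trans (cong (λ z → x ⁻¹ ∙ z ∙ x) (isYes⇒ (q ≟ e) q≡e))
              (solve (x ∷ []) (𝐚 ′ ⊕ one ⊕ 𝐚) one refl))
            (IsSubgroup.e∈ sub))
          (λ _ → tt))
      }

    module Extend {Q : Subset H} (S : StableTwoSubgroup Q) where
      open StableTwoSubgroup S

      -- Conjugation by x maps the finite set Q injectively to itself, hence onto.
      Fixes-⁻¹ : ∀ {x} → Fixes Q Q x → Fixes Q Q (x ⁻¹)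
      Fixes-⁻¹ {x} fix q q∈ =
        let p , p∈ , eq = count-surjective (λ z → Q z ≟ᵇ true) (λ z → x ⁻¹ ∙ z ∙ x) fix
              (λ {a} {b} _ _ eq → trans (back a) (trans (cong (λ z → x ∙ z ∙ x ⁻¹) eq) (sym (back b)))) q q∈
        in ∈-≡ (trans (cong (λ z → x ⁻¹ ⁻¹ ∙ z ∙ x ⁻¹) (sym eq))
                 (solve (x ∷ p ∷ []) (𝐚 ′ ′ ⊕ (𝐚 ′ ⊕ 𝐛 ⊕ 𝐚) ⊕ 𝐚 ′) 𝐛 refl)) p∈
        where
        back : ∀ a → a ≡ x ∙ (x ⁻¹ ∙ a ∙ x) ∙ x ⁻¹
        back a = solve (x ∷ a ∷ []) 𝐛 (𝐚 ⊕ (𝐚 ′ ⊕ 𝐛 ⊕ 𝐚) ⊕ 𝐚 ′) refl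

      -- Inversion need not respect left cosets outside the normaliser. Here `x ∙ y ⁻¹` is the
      -- conjugate by `x` of the inverse of `x ⁻¹ ∙ y`, and stays in `Q` because `x` normalises `Q`.
      ⁻¹-resp : ∀ {x y} → Fixes Q Q x → x ~ y → x ⁻¹ ~ y ⁻¹
      ⁻¹-resp {x} {y} fix p =
        ∈-≡ (solve (x ∷ y ∷ []) (𝐚 ′ ′ ⊕ 𝐛 ′) (𝐚 ′ ′ ⊕ (𝐚 ′ ⊕ 𝐛) ′ ⊕ 𝐚 ′) refl) (Fixes-⁻¹ fix _ (inv∈ _ p))

      Fixes-σ : ∀ {x} → Fixes Q Q x → Fixes Q Q (σ x)
      Fixes-σ {x} fix q q∈ = ∈-≡ (sym (begin
        σ (x ⁻¹ ∙ σ q ∙ x)         ≡⟨ hom _ x ⟩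
        σ (x ⁻¹ ∙ σ q) ∙ σ x       ≡⟨ cong (_∙ σ x) (σ-/ x (σ q)) ⟩
        σ x ⁻¹ ∙ σ (σ q) ∙ σ x     ≡⟨ cong (λ z → σ x ⁻¹ ∙ z ∙ σ x) (σσ q) ⟩
        σ x ⁻¹ ∙ q ∙ σ x           ∎)) (stable _ (fix _ (stable q q∈)))
        where open ≡-Reasoning

      σ-fixed : Pred G 0ℓ
      σ-fixed x = Fixes Q Q x × σ x ~ x

      σ-fixed-resp : ∀ {x y} → x ~ y → σ-fixed x → σ-fixed y
      σ-fixed-resp p (fix , q) = Fixes-resp subgroup p fix , ~-trans (σ-resp (~-sym p)) (~-trans q p)

      -- An element of order at most 2 in the subgroup of σ-fixed points of N(Q)/Q.
      Admissible : Pred G 0ℓ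
      Admissible x = σ-fixed x × x ⁻¹ ~ x

      Admissible-resp : ∀ {x y} → x ~ y → Admissible x → Admissible y
      Admissible-resp p (f@(fix , _) , q) =
        σ-fixed-resp p f , ~-trans (~-sym (⁻¹-resp fix p)) (~-trans q p)

      Admissible-e : Admissible e
      Admissible-e = ((λ q q∈ → ∈-≡ (solve (q ∷ []) (one ′ ⊕ 𝐚 ⊕ one) 𝐚 refl) q∈)
                     , ∈-≡ (trans (cong (λ z → z ⁻¹ ∙ e) σ-e) (inverseˡ e)) e∈)
                     , ∈-≡ (solve [] (one ′ ′ ⊕ one) one refl) e∈

      -- Read from the inside out: `parity` with `R` equal to `Q` makes N(Q)/Q even, then `σ` and
      -- then inversion cut it down to fixed points, keeping the count even. This takes the place of
      -- Cauchy's theorem in N(Q)/Q.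
      admissible : 2 ∣ index → ∃ λ x → Admissible x × ¬ x ∈K
      admissible even = even-nontrivial (λ x → (fixes? Q Q x ×-dec (σ x ~? x)) ×-dec (x ⁻¹ ~? x))
        Admissible-resp Admissible-e
        (even-fixed (λ x → fixes? Q Q x ×-dec (σ x ~? x)) _⁻¹ σ-fixed-resp (⁻¹-resp ∘ proj₁)
          -- `⁻¹-resp` asks that its left argument normalise `Q`, which `fix` gives for `x`; hence
          -- the relation is reversed before and after.
          (λ {x} (fix , p) → Fixes-⁻¹ fix , subst (_~ x ⁻¹) (sym (σ-⁻¹ x)) (~-sym (⁻¹-resp fix (~-sym p))))
          (λ {x} _ → subst (_~ x) (solve (x ∷ []) 𝐚 (𝐚 ′ ′) refl) ~-refl)
          (even-fixed (fixes? Q Q) σ (Fixes-resp subgroup) (λ _ → σ-resp) Fixes-σ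
            (λ {x} _ → subst (_~ x) (sym (σσ x)) ~-refl)
            (parity subgroup even)))
        where open CosetParity subgroup

      extend-by : ∀ h → Admissible h → ¬ h ∈K →
                  ∃ λ Q′ → StableTwoSubgroup Q′ × card H Q′ ≡ 2 * card H Q
      extend-by h ((normalizes , σh~h) , h⁻¹~h) h∉ = Q′ , record
        { subgroup = adjoin-subgroup
        ; stable   = λ z z∈ → adjoin-stable z (∨-split (Q z) z∈)
        ; exponent = suc exponent
        ; card≡    = trans adjoin-card (cong (2 *_) card≡)
        ; parity   = adjoin-parity parity
        } , adjoin-card
        where
        -- `h ⁻¹ ~ h` unfolds to `h ⁻¹ ⁻¹ ∙ h` being in `Q`, that is, to the condition on `h ∙ h`.
        open Adjoin subgroup h h∉ normalizes (∈-≡ (solve (h ∷ []) (𝐚 ⊕ 𝐚) (𝐚 ′ ′ ⊕ 𝐚) refl) h⁻¹~h)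
        adjoin-stable : ∀ z → z ∈K ⊎ h ~ z → Q′ (σ z) ≡ true
        adjoin-stable z (inj₁ z∈)  = ∈ˡ (stable z z∈)
        adjoin-stable z (inj₂ h~z) = ∈ʳ (~-trans (~-sym σh~h) (σ-resp h~z))

      extend : 2 ∣ index → ∃ λ Q′ → StableTwoSubgroup Q′ × card H Q′ ≡ 2 * card H Q
      extend even = let h , adm , h∉ = admissible even in extend-by h adm h∉

    -- Existence of a stable Sylow 2-subgroup

    OddStable : Subset H → Set
    OddStable Q = Σ (StableTwoSubgroup Q) λ S → ¬ 2 ∣ StableTwoSubgroup.index S

    index>0 : ∀ {Q} (sub : IsSubgroup H Q) → 1 ≤ Cosets.index sub
    index>0 sub = count-some (λ x → (rep x ≟ x) ×-dec U? x) (rep e , sym (rep-cong (~-rep e)) , tt)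
      where open Cosets sub

    -- Lagrange for both subgroups gives the same order. The cancelled factor is written as a power
    -- of 2, which is visibly nonzero.
    index-halves : ∀ {Q Q′} (S : StableTwoSubgroup Q) (S′ : StableTwoSubgroup Q′) →
                   card H Q′ ≡ 2 * card H Q →
                   StableTwoSubgroup.index S′ * 2 ≡ StableTwoSubgroup.index S
    index-halves {Q} {Q′} S S′ double =
      *-cancelʳ-≡ _ _ (2 ^ exponent S) {{m^n≢0 2 (exponent S)}} (begin
        index S′ * 2 * 2 ^ exponent S      ≡⟨ *-assoc (index S′) 2 _ ⟩
        index S′ * (2 * 2 ^ exponent S)    ≡⟨ cong (λ c → index S′ * (2 * c)) (card≡ S) ⟨
        index S′ * (2 * card H Q)          ≡⟨ cong (index S′ *_) double ⟨
        index S′ * card H Q′               ≡⟨ lagrange S′ ⟨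
        order                              ≡⟨ lagrange S ⟩
        index S * card H Q                 ≡⟨ cong (index S *_) (card≡ S) ⟩
        index S * 2 ^ exponent S           ∎)
      where
      open ≡-Reasoning
      open StableTwoSubgroup

    -- The fuel bounds the index, which is positive and halves at each extension; fuel 0 is
    -- therefore impossible. The start is the index of the trivial subgroup.
    enlarge : ∀ fuel {Q} (S : StableTwoSubgroup Q) → StableTwoSubgroup.index S ≤ fuel → ∃ OddStable
    enlarge zero S bound = contradiction (≤-trans (index>0 (StableTwoSubgroup.subgroup S)) bound) λ ()
    enlarge (suc fuel) {Q} S bound = go (2 ∣? StableTwoSubgroup.index S)
      where
      open StableTwoSubgroup
      go : Dec (2 ∣ index S) → ∃ OddStable
      go (no odd)   = Q , S , odd
      go (yes even) =
        let Q′ , S′ , double = Extend.extend S even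
            smaller = subst (index S′ <_) (index-halves S S′ double)
              (m<m*n (index S′) 2 {{>-nonZero (index>0 (subgroup S′))}} (s≤s (s≤s z≤n)))
        in enlarge fuel S′ (≤-pred (≤-trans smaller bound))

    stable-sylow : ∃ OddStable
    stable-sylow = enlarge _ trivial ≤-refl

    open SemiDirect H σ using (conj; inSᵇ; isRepᵇ)

    -- Conjugacy classes in S

    InS : Subset H → Pred G 0ℓ
    InS K k = K k ≡ true × k ∙ σ k ≡ e

    -- Conjugation of (k , x) by (h , e).
    twist : G → G → G
    twist h k = h ∙ k ∙ σ (h ⁻¹)

    twist-∙ : ∀ g h k → twist g (twist h k) ≡ twist (g ∙ h) k
    twist-∙ g h k = begin
      g ∙ (h ∙ k ∙ σ (h ⁻¹)) ∙ σ (g ⁻¹)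
        ≡⟨ solve (g ∷ h ∙ k ∷ σ (h ⁻¹) ∷ σ (g ⁻¹) ∷ []) (𝐚 ⊕ (𝐛 ⊕ 𝐜) ⊕ 𝐝) (𝐚 ⊕ 𝐛 ⊕ (𝐜 ⊕ 𝐝)) refl ⟩
      g ∙ (h ∙ k) ∙ (σ (h ⁻¹) ∙ σ (g ⁻¹))
        ≡⟨ cong₂ _∙_ (sym (assoc g h k)) (trans (sym (hom _ _))
             (cong σ (solve (g ∷ h ∷ []) (𝐛 ′ ⊕ 𝐚 ′) ((𝐚 ⊕ 𝐛) ′) refl))) ⟩
      g ∙ h ∙ k ∙ σ ((g ∙ h) ⁻¹) ∎
      where open ≡-Reasoning

    twist-e : ∀ k → twist e k ≡ k
    twist-e k = trans (cong (e ∙ k ∙_) (trans (σ-⁻¹ e) (cong _⁻¹ σ-e)))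
                  (solve (k ∷ []) (one ⊕ 𝐚 ⊕ one ′) 𝐚 refl)

    -- Conjugators from `K` alone suffice: for `(k , x)` in S over `K`, each element of K ⋊ Z₂
    -- outside `K` is an element of `K` times `(k , x)`, which commutes with itself.
    Twist : Subset H → G → G → Set
    Twist K j k = ∃ λ h → K h ≡ true × twist h j ≡ k

    twist? : ∀ K j → Decidable (Twist K j)
    twist? K j k = any? λ h → (K h ≟ᵇ true) ×-dec (twist h j ≟ k)

    module _ {K : Subset H} (sub : IsSubgroup H K) where
      open IsSubgroup sub

      Twist-trans : ∀ {i j k} → Twist K i j → Twist K j k → Twist K i k
      Twist-trans {i} (h , h∈ , refl) (g , g∈ , refl) = g ∙ h , ·∈ g h g∈ h∈ , sym (twist-∙ g h i)

      Twist-sym : ∀ {j k} → Twist K j k → Twist K k j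
      Twist-sym {j} (h , h∈ , refl) = h ⁻¹ , inv∈ h h∈ ,
        trans (twist-∙ (h ⁻¹) h j) (trans (cong (λ g → twist g j) (inverseˡ h)) (twist-e j))

      -- The square of a conjugate is the conjugate of the square; stability of `K` under `σ` keeps
      -- the twist in `K`.
      Twist-InS : (∀ x → K x ≡ true → K (σ x) ≡ true) → ∀ {j k} → Twist K j k → InS K j → InS K k
      Twist-InS stable {j} (h , h∈ , refl) (j∈ , jσj≡e) = ·∈ _ _ (·∈ h j h∈ j∈) (stable _ (inv∈ h h∈)) , (begin
        h ∙ j ∙ σ (h ⁻¹) ∙ σ (h ∙ j ∙ σ (h ⁻¹))
          ≡⟨ cong₂ (λ s t → h ∙ j ∙ s ∙ t) (σ-⁻¹ h)
               (trans (hom _ _) (cong₂ _∙_ (hom h j) (σσ (h ⁻¹)))) ⟩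
        h ∙ j ∙ σ h ⁻¹ ∙ (σ h ∙ σ j ∙ h ⁻¹)
          ≡⟨ solve (h ∷ j ∷ σ h ∷ σ j ∷ []) (𝐚 ⊕ 𝐛 ⊕ 𝐜 ′ ⊕ (𝐜 ⊕ 𝐝 ⊕ 𝐚 ′)) (𝐚 ⊕ (𝐛 ⊕ 𝐝) ⊕ 𝐚 ′) refl ⟩
        h ∙ (j ∙ σ j) ∙ h ⁻¹
          ≡⟨ cong (λ z → h ∙ z ∙ h ⁻¹) jσj≡e ⟩
        h ∙ e ∙ h ⁻¹
          ≡⟨ solve (h ∷ []) (𝐚 ⊕ one ⊕ 𝐚 ′) one refl ⟩
        e ∎)
        where open ≡-Reasoning

    InS⇒ : ∀ {K k} → inSᵇ K k ≡ true → InS K k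
    InS⇒ {K} {k} p = let k∈ , q = ∧-split (K k) p in k∈ , isYes⇒ (k ∙ σ k ≟ e) q

    ⇒InS : ∀ {K k} → InS K k → inSᵇ K k ≡ true
    ⇒InS {K} {k} (k∈ , q) = cong₂ _∧_ k∈ (⇒isYes (k ∙ σ k ≟ e) q)

    isRep-least : ∀ {K k} → isRepᵇ K k ≡ true → ∀ {j} → Twist K k j → toℕ k ≤ toℕ j
    isRep-least {K} {k} p (h , h∈ , refl) with all-tabulate⁻ _ id (proj₂ (∧-split (inSᵇ K k) p)) h
    -- The list is `true`, then `false`; its second entry, conjugation by `(h , false)`, is the
    -- twist.
    ... | q rewrite h∈ = ≤ᵇ⇒≤ _ _ (subst T (sym (proj₁ (∧-split (toℕ k ≤ᵇ toℕ (h ∙ k ∙ σ (h ⁻¹)))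
      (proj₂ (∧-split (toℕ k ≤ᵇ toℕ (h ∙ σ k ∙ σ (h ⁻¹))) q))))) tt)

    -- Conjugation by (h , x) acts on S as conjugation by (h · σ k , e).
    isRep-intro : ∀ {K} → IsSubgroup H K → (∀ x → K x ≡ true → K (σ x) ≡ true) →
                  ∀ {k} → InS K k → (∀ j → Twist K k j → toℕ k ≤ toℕ j) → isRepᵇ K k ≡ true
    isRep-intro {K} sub stable {k} k∈S@(k∈ , _) minimal =
      cong₂ _∧_ (⇒InS {K} k∈S) (all-tabulate⁺ _ id bound)
      where
      ≤ᵇ-true : ∀ {m n} → m ≤ n → (m ≤ᵇ n) ≡ true
      ≤ᵇ-true p = Equivalence.to T-≡ (≤⇒≤ᵇ p)
      bound : ∀ h → (if K h then all (λ b → toℕ k ≤ᵇ toℕ (proj₁ (conj (h , b) (k , true))))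
                               (true ∷ false ∷ []) else true) ≡ true
      bound h with K h in h∈
      ... | false = refl
      ... | true  = cong₂ _∧_
        (≤ᵇ-true (minimal _ (h ∙ σ k , IsSubgroup.·∈ sub h _ h∈ (stable k k∈) , twist-xk)))
        (cong₂ _∧_ (≤ᵇ-true (minimal _ (h , h∈ , refl))) refl)
        where
        open ≡-Reasoning
        twist-xk : twist (h ∙ σ k) k ≡ h ∙ σ k ∙ σ (h ⁻¹)
        twist-xk = begin
          h ∙ σ k ∙ k ∙ σ ((h ∙ σ k) ⁻¹)
            ≡⟨ cong (h ∙ σ k ∙ k ∙_) (trans (σ-⁻¹ _) (cong _⁻¹ (trans (hom h _) (cong (σ h ∙_) (σσ k))))) ⟩
          h ∙ σ k ∙ k ∙ (σ h ∙ k) ⁻¹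
            ≡⟨ solve (h ∷ σ k ∷ k ∷ σ h ∷ []) (𝐚 ⊕ 𝐛 ⊕ 𝐜 ⊕ (𝐝 ⊕ 𝐜) ′) (𝐚 ⊕ 𝐛 ⊕ 𝐝 ′) refl ⟩
          h ∙ σ k ∙ σ h ⁻¹
            ≡⟨ cong (h ∙ σ k ∙_) (sym (σ-⁻¹ h)) ⟩
          h ∙ σ k ∙ σ (h ⁻¹) ∎

    whole-subgroup : IsSubgroup H (whole H)
    whole-subgroup = record { e∈ = refl ; ·∈ = λ _ _ _ _ → refl ; inv∈ = λ _ _ → refl }

    -- Comparison of the classes in H and in P

    module _ {P : Subset H} (S : StableTwoSubgroup P) (odd : ¬ 2 ∣ StableTwoSubgroup.index S) where
      open StableTwoSubgroup S

      twist-into : ∀ k → k ∙ σ k ≡ e → ∃ λ j → P j ≡ true × Twist (whole H) k j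
      twist-into k kσk≡e =
        let a , p = CosetParity.odd-fixed subgroup (λ a → k ∙ σ a) (λ q → translate-~ k (σ-resp q))
              (λ a → subst (_~ a) (sym (invol a)) ~-refl) odd
        -- That `k ∙ σ a` and `a` share a coset says precisely that this element, the twist of `k`
        -- by `a ⁻¹`, is in `P`.
        in a ⁻¹ ∙ (k ∙ σ a) , ~-sym p , a ⁻¹ , refl , trans (assoc _ _ _)
             (cong (λ z → a ⁻¹ ∙ (k ∙ σ z)) (solve (a ∷ []) (𝐚 ′ ′) 𝐚 refl))
        where
        open ≡-Reasoning
        invol : ∀ a → k ∙ σ (k ∙ σ a) ≡ a
        invol a = begin
          k ∙ σ (k ∙ σ a)     ≡⟨ cong (k ∙_) (trans (hom k _) (cong (σ k ∙_) (σσ a))) ⟩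
          k ∙ (σ k ∙ a)       ≡⟨ assoc k _ a ⟨
          k ∙ σ k ∙ a         ≡⟨ cong (_∙ a) kσk≡e ⟩
          e ∙ a               ≡⟨ identityˡ a ⟩
          a                   ∎

      -- The least twist of `j` by `P` is chosen. Every twist of it is again a twist of `j`, so it
      -- is minimal in its own class.
      rep-of : ∀ j → InS P j → ∃ λ r → isRepᵇ P r ≡ true × Twist P j r
      rep-of j j∈S = go (least (twist? P j) (j , e , e∈ , twist-e j))
        where
        go : (∃ λ r → Twist P j r × (∀ i → Twist P j i → toℕ r ≤ toℕ i)) →
             ∃ λ r → isRepᵇ P r ≡ true × Twist P j r
        go (r , u , minimal) = r , isRep-intro subgroup stable (Twist-InS subgroup stable u j∈S)
                                     (λ i v → minimal i (Twist-trans subgroup u v)) , u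

      rep-in : ∀ k → k ∙ σ k ≡ e → ∃ λ r → isRepᵇ P r ≡ true × Twist (whole H) k r
      rep-in k kσk≡e = go (twist-into k kσk≡e)
        where
        go : (∃ λ j → P j ≡ true × Twist (whole H) k j) → ∃ λ r → isRepᵇ P r ≡ true × Twist (whole H) k r
        go (j , j∈ , t) =
          let r , r-rep , h , _ , eq = rep-of j (j∈ , proj₂ (Twist-InS {whole H} whole-subgroup (λ _ _ → refl) t (refl , kσk≡e)))
          in r , r-rep , Twist-trans {whole H} whole-subgroup t (h , refl , eq)

      -- Representatives for H are related to representatives for `P` by conjugacy in H. Two of the
      -- former related to the same one of the latter are conjugate, and both are least in their
      -- class, hence equal.
      GTF-≤ : GTF H σ (whole H) ≤ GTF H σ P
      GTF-≤ = subst₂ _≤_ (sym (length-filter (isRepᵇ (whole H)) id)) (sym (length-filter (isRepᵇ P) id))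
        (count-≤ (λ k → isRepᵇ (whole H) k ≟ᵇ true) (λ k → isRepᵇ P k ≟ᵇ true) (twist? (whole H))
          (λ k k-rep → rep-in k (proj₂ (InS⇒ {whole H} (proj₁ (∧-split (inSᵇ (whole H) k) k-rep)))))
          λ {k} {k′} k-rep k′-rep t t′ → toℕ-injective (≤-antisym
            (isRep-least {whole H} k-rep (Twist-trans whole-subgroup t (Twist-sym whole-subgroup t′)))
            (isRep-least {whole H} k′-rep (Twist-trans whole-subgroup t′ (Twist-sym whole-subgroup t)))))

theorem10p1 : (H : FinGroup) (σ : El H → El H) → InvolutiveAut H σ →
    Σ (Subset H) λ P → IsSylow2 H P × Stable H σ P × (GTF H σ (whole H) ≤ GTF H σ P)
-- As `σ` is an involution, `σ y` is the preimage of `y` that the second half of stability demands.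
theorem10p1 H σ aut = P , sylow , (stable , λ y y∈ → σ y , stable y y∈ , InvolutiveAut.inv aut y) , GTF-≤ S odd
  where
  open FinGroupTheory H
  open Involutive σ aut
  P = proj₁ stable-sylow
  S = proj₁ (proj₂ stable-sylow)
  odd = proj₂ (proj₂ stable-sylow)
  open StableTwoSubgroup S
  sylow : IsSylow2 H P
  sylow = record
    { subgroup = subgroup
    ; a        = exponent
    ; m        = index
    ; cardP    = card≡
    ; orderH   = trans lagrange (trans (cong (index *_) card≡) (*-comm index _))
    ; m-odd    = odd
    }
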